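{- Let $G_1$ and $G_2$ be finite simple undirected graphs. Then $G_1\cong G_2$ if and only if $\sigma(G_1)=\sigma(G_2)$.
   Context: A clique is a set of pairwise adjacent vertices; a set $S$ of cliques of $G$ is a total clique covering if every vertex lies in some member of $S$ and every edge has both endpoints in some member of $S$; $\theta_t(G)$ is the minimum size of a total clique covering. The code $\sigma(G)$ of a graph $G=(V,E)$ with $|V|=m$ and $s\ge0$ isolated vertices is defined as follows. Let $k=\theta_t(G)-s$. For a total clique covering $S=\{C_1,\ldots,C_{s+k}\}$ with $|S|=\theta_t(G)$, where $C_1,\ldots,C_s$ are the singleton cliques of the isolated vertices, and for each bijective assignment of the first $k$ primes to the cliques $C_{s+1},\ldots,C_{s+k}$, label each vertex $v$ by $1$ if $v$ is isolated and otherwise by the product of the primes assigned to the cliques among $C_{s+1},\ldots,C_{s+k}$ that contain $v$; listing these labels in non-decreasing order gives a sequence in $\mathbb{Z}^m$ (a coding sequence). Let $\sigma[S]$ be the lexicographically least of the (at most $k!$) sequences so obtained. Then $\sigma(G)$ is the lexicographically least element of $\{\sigma[S] : S \text{ a total clique covering of } G \text{ with } |S|=\theta_t(G)\}$. -}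

module Defs where

open import Data.Bool.Base using (true; false; if_then_else_)
open import Data.Fin.Base using (Fin; toℕ)
open import Data.Fin.Permutation using (Permutation; permutation; cast-id; _⟨$⟩ʳ_; _⟨$⟩ˡ_; inverseˡ; inverseʳ)
import Data.Fin.Properties as Fin
open import Data.Fin.Subset using (Subset; _∈_; _∪_; ⁅_⁆)
open import Data.Fin.Subset.Properties using (_∈?_; x∈⁅x⁆; x∈⁅y⁆⇒x≡y; x∈p∪q⁺; x∈p∪q⁻; ⊆-antisym)
open import Data.List.Base using (List; []; _∷_; length; map; filter; allFin; lookup; cartesianProduct; concatMap; deduplicate)
import Data.List.Extrema as Extrema
open import Data.List.Membership.Propositional using (find; lose) renaming (_∈_ to _∈ₗ_)
open import Data.List.Membership.Propositional.Properties using (∈-allFin; ∈-cartesianProduct⁺; ∈-concatMap⁺; ∈-deduplicate⁺; ∈-deduplicate⁻; ∈-filter⁺; ∈-filter⁻; ∈-map⁺; ∈-map⁻)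
open import Data.List.Membership.Propositional.Properties.WithK using (unique∧set⇒bag)
open import Data.List.Properties using (length-map; map-cong)
open import Data.List.Relation.Binary.BagAndSetEquality using (∼bag⇒↭)
open import Data.List.Relation.Binary.Lex.Strict using (Lex-≤; ≤-decTotalOrder)
open import Data.List.Relation.Binary.Permutation.Propositional.Properties using (↭-length)
open import Data.List.Relation.Unary.All as All using (All; []; _∷_)
open import Data.List.Relation.Unary.Any as Any using (Any; here; there)
import Data.List.Relation.Unary.Any.Properties as Any
open import Data.List.Relation.Unary.Unique.Propositional using (Unique)
import Data.List.Relation.Unary.Unique.DecPropositional as DecUnique
open import Data.List.Relation.Unary.Unique.DecPropositional.Properties using (deduplicate-!)
import Data.List.Relation.Unary.Unique.Propositional.Properties as Unique
open import Data.List.Sort using (sort)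
open import Data.Nat.Base using (ℕ; zero; suc; _+_; _∸_; _≤_; _<_; _!)
open import Data.Nat.Divisibility using (_∣_; ∣-trans; ∣1⇒≡1; ∣m+n∣m⇒∣n; m∣m*n; m≤n⇒m!∣n!)
open import Data.Nat.Induction using (<-rec)
open import Data.Nat.ListAction using (product)
open import Data.Nat.Primality using (Prime; prime?; ¬prime[0]; ¬prime[1])
open import Data.Nat.Primality.Factorisation using (factorise)
import Data.Nat.Properties as ℕ
open import Data.Product.Base using (∃; _×_; _,_; proj₁; proj₂)
open import Data.Sum.Base using (inj₁; inj₂)
open import Data.Vec.Base as Vec using (Vec; []; _∷_)
import Data.Vec.Properties as Vec
import Data.Bool.Properties as Bool
open import Function.Base using (_∘_)
open import Function.Bundles using (_⇔_; _↔_; mk⇔; Inverse)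
open import Level using (0ℓ)
open import Relation.Binary.Bundles using (DecTotalOrder)
open import Relation.Binary.Core using (Rel)
import Relation.Binary.Definitions as B
open import Relation.Binary.PropositionalEquality using (_≡_; _≢_; refl; sym; trans; cong; subst; module ≡-Reasoning)
open import Relation.Nullary.Decidable using (yes; no; does; ¬?; _×-dec_; _→-dec_)
open import Relation.Nullary.Negation using (¬_; contradiction)
open import Relation.Unary using (Pred; Decidable)

IsLeast : {A : Set} → Rel A 0ℓ → Pred A 0ℓ → Pred A 0ℓ
IsLeast _≼_ P x = P x × (∀ {y} → P y → x ≼ y)

private
  least-ℕ : {P : Pred ℕ 0ℓ} → Decidable P → ∃ P → ∃ (IsLeast _≤_ P)
  least-ℕ {P} P? (n , Pn) = <-rec (λ m → P m → ∃ (IsLeast _≤_ P)) step n Pn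
    where
    step : ∀ m → (∀ {i} → i < m → P i → ∃ (IsLeast _≤_ P)) → P m → ∃ (IsLeast _≤_ P)
    step m rec Pm with ℕ.anyUpTo? P? m
    ... | yes (i , i<m , Pi) = rec i<m Pi
    ... | no none = m , Pm , λ Py → ℕ.≮⇒≥ (λ y<m → none (_ , y<m , Py))

  ∣factorial : ∀ {m n} → m ≢ 0 → m ≤ n → m ∣ n !
  ∣factorial {zero}  m≢0 _   = contradiction refl m≢0
  ∣factorial {suc m} _   m≤n = ∣-trans (m∣m*n (m !)) (m≤n⇒m!∣n! m≤n)

  primeDivisor : ∀ n → ∃ λ p → Prime p × p ∣ suc (suc n)
  primeDivisor n with factorise (suc (suc n))
  ... | record { factors = p ∷ ps ; isFactorisation = eq ; factorsPrime = pr ∷ _ } =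
    p , pr , subst (p ∣_) (sym eq) (m∣m*n (product ps))

  primeAbove : ∀ n → ∃ λ p → Prime p × n < p
  primeAbove n with n ! in eq | ℕ.1≤n! n
  ... | suc f | _ with primeDivisor f
  ...   | p , pr , p∣ = p , pr , ℕ.≰⇒> λ p≤n →
    ¬prime[1] (subst Prime
      (∣1⇒≡1 (∣m+n∣m⇒∣n {p} {suc f} {1} (subst (p ∣_) (ℕ.+-comm 1 (suc f)) p∣)
        (subst (p ∣_) eq (∣factorial (λ { refl → ¬prime[0] pr }) p≤n)))) pr)

  leastPrimeAbove : ∀ n → ∃ (IsLeast _≤_ (λ p → Prime p × n < p))
  leastPrimeAbove n = least-ℕ (λ p → prime? p ×-dec (n ℕ.<? p)) (primeAbove n)

nextPrime : ℕ → ℕ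
nextPrime n = proj₁ (leastPrimeAbove n)

nextPrime-isLeast : ∀ n → IsLeast _≤_ (λ p → Prime p × n < p) (nextPrime n)
nextPrime-isLeast n = proj₂ (leastPrimeAbove n)

-- Numbered from 0: 2, 3, 5, …
nthPrime : ℕ → ℕ
nthPrime zero    = nextPrime 0
nthPrime (suc i) = nextPrime (nthPrime i)

infix 4 _≤ˡᵉˣ_

_≤ˡᵉˣ_ : Rel (List ℕ) 0ℓ
_≤ˡᵉˣ_ = Lex-≤ _≡_ _<_

record Graph : Set₁ where
  field
    order     : ℕ
    Adj       : Rel (Fin order) 0ℓ
    adj?      : B.Decidable Adj
    symmetric : B.Symmetric Adj
    loopless  : ∀ {v} → ¬ Adj v v

infix 4 _≅_

record _≅_ (G H : Graph) : Set where
  private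
    module G = Graph G
    module H = Graph H
  field
    bijection : Fin G.order ↔ Fin H.order
    adjacency : ∀ u v → G.Adj u v ⇔ H.Adj (Inverse.to bijection u) (Inverse.to bijection v)

private
  vecs : {A : Set} → List A → ∀ n → List (Vec A n)
  vecs as zero    = [] ∷ []
  vecs as (suc n) = map (λ (a , v) → a ∷ v) (cartesianProduct as (vecs as n))

  ∈-vecs : {A : Set} {as : List A} → (∀ a → a ∈ₗ as) → ∀ {n} (v : Vec A n) → v ∈ₗ vecs as n
  ∈-vecs all []      = here refl
  ∈-vecs all (a ∷ v) = ∈-map⁺ _ (∈-cartesianProduct⁺ (all a) (∈-vecs all v))

  subsets : ∀ n → List (Subset n)
  subsets = vecs (true ∷ false ∷ [])

  ∈-subsets : ∀ {n} (p : Subset n) → p ∈ₗ subsets n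
  ∈-subsets = ∈-vecs λ { true → here refl ; false → there (here refl) }

  families : ∀ n l → List (List (Subset n))
  families n l = map Vec.toList (vecs (subsets n) l)

  ∈-families : ∀ {n} (S : List (Subset n)) → S ∈ₗ families n (length S)
  ∈-families S = subst (_∈ₗ families _ (length S)) (Vec.toList∘fromList S) (∈-map⁺ Vec.toList (∈-vecs ∈-subsets (Vec.fromList S)))

  _≟ₛ_ : ∀ {n} → B.DecidableEquality (Subset n)
  _≟ₛ_ = Vec.≡-dec Bool._≟_

module _ (G : Graph) where
  open Graph G

  IsClique : Pred (Subset order) 0ℓ
  IsClique C = ∀ u v → u ∈ C → v ∈ C → u ≢ v → Adj u v

  -- A set of vertex subsets is a duplicate-free list, so its size is the length.
  record IsTotalCliqueCovering (S : List (Subset order)) : Set where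
    field
      distinct      : Unique S
      cliques       : All IsClique S
      coversVertex  : ∀ v → Any (v ∈_) S
      coversEdge    : ∀ u v → Adj u v → Any (λ C → u ∈ C × v ∈ C) S

  isClique? : Decidable IsClique
  isClique? C = Fin.all? λ u → Fin.all? λ v →
    (u ∈? C) →-dec ((v ∈? C) →-dec (¬? (u Fin.≟ v) →-dec adj? u v))

  isTotalCliqueCovering? : Decidable IsTotalCliqueCovering
  isTotalCliqueCovering? S
    with DecUnique.unique? _≟ₛ_ S
       | All.all? isClique? S
       | Fin.all? (λ v → Any.any? (v ∈?_) S)
       | Fin.all? (λ u → Fin.all? λ v → adj? u v →-dec Any.any? (λ C → (u ∈? C) ×-dec (v ∈? C)) S)
  ... | no ¬p | _ | _ | _ = no (¬p ∘ IsTotalCliqueCovering.distinct)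
  ... | yes _ | no ¬p | _ | _ = no (¬p ∘ IsTotalCliqueCovering.cliques)
  ... | yes _ | yes _ | no ¬p | _ = no (¬p ∘ IsTotalCliqueCovering.coversVertex)
  ... | yes _ | yes _ | yes _ | no ¬p = no (¬p ∘ IsTotalCliqueCovering.coversEdge)
  ... | yes p | yes q | yes r | yes s =
    yes (record { distinct = p ; cliques = q ; coversVertex = r ; coversEdge = s })

  private
    allCliques : List (Subset order)
    allCliques = deduplicate _≟ₛ_ (filter isClique? (subsets order))

    ∈-allCliques : ∀ {C} → IsClique C → C ∈ₗ allCliques
    ∈-allCliques cl = ∈-deduplicate⁺ _≟ₛ_ (∈-filter⁺ isClique? (∈-subsets _) cl)

    singleton-isClique : ∀ v → IsClique ⁅ v ⁆
    singleton-isClique v x y x∈ y∈ x≢y =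
      contradiction (trans (x∈⁅y⁆⇒x≡y v x∈) (sym (x∈⁅y⁆⇒x≡y v y∈))) x≢y

    pair-isClique : ∀ {u v} → Adj u v → IsClique (⁅ u ⁆ ∪ ⁅ v ⁆)
    pair-isClique {u} {v} uv x y x∈ y∈ x≢y
      with x∈p∪q⁻ ⁅ u ⁆ ⁅ v ⁆ x∈ | x∈p∪q⁻ ⁅ u ⁆ ⁅ v ⁆ y∈
    ... | inj₁ p | inj₁ q = singleton-isClique u x y p q x≢y
    ... | inj₂ p | inj₂ q = singleton-isClique v x y p q x≢y
    ... | inj₁ p | inj₂ q rewrite x∈⁅y⁆⇒x≡y u p | x∈⁅y⁆⇒x≡y v q = uv
    ... | inj₂ p | inj₁ q rewrite x∈⁅y⁆⇒x≡y v p | x∈⁅y⁆⇒x≡y u q = symmetric uv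

    allCliques-cover : IsTotalCliqueCovering allCliques
    allCliques-cover = record
      { distinct     = deduplicate-! _≟ₛ_ _
      ; cliques      = All.tabulate λ C∈ →
          proj₂ (∈-filter⁻ isClique? {xs = subsets order} (∈-deduplicate⁻ _≟ₛ_ (filter isClique? (subsets order)) C∈))
      ; coversVertex = λ v → lose (∈-allCliques (singleton-isClique v)) (x∈⁅x⁆ v)
      ; coversEdge   = λ u v uv → lose (∈-allCliques (pair-isClique uv))
          (x∈p∪q⁺ (inj₁ (x∈⁅x⁆ u)) , x∈p∪q⁺ {p = ⁅ u ⁆} (inj₂ (x∈⁅x⁆ v)))
      }

  HasTotalCliqueCoveringOfSize : Pred ℕ 0ℓ
  HasTotalCliqueCoveringOfSize n = ∃ λ S → IsTotalCliqueCovering S × length S ≡ n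

  private
    hasTotalCliqueCoveringOfSize? : Decidable HasTotalCliqueCoveringOfSize
    hasTotalCliqueCoveringOfSize? n
      with Any.any? (λ S → isTotalCliqueCovering? S ×-dec (length S ℕ.≟ n)) (families order n)
    ... | yes found = yes (Any.satisfied found)
    ... | no none   = no λ { (S , cov , refl) → none (lose (∈-families S) (cov , refl)) }

    leastSize : ∃ (IsLeast _≤_ HasTotalCliqueCoveringOfSize)
    leastSize = least-ℕ hasTotalCliqueCoveringOfSize? (_ , allCliques , allCliques-cover , refl)

  θₜ : ℕ
  θₜ = proj₁ leastSize

  θₜ-isLeast : IsLeast _≤_ HasTotalCliqueCoveringOfSize θₜ
  θₜ-isLeast = proj₂ leastSize

  IsMinimumCovering : Pred (List (Subset order)) 0ℓ
  IsMinimumCovering S = IsTotalCliqueCovering S × length S ≡ θₜ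

  Isolated : Pred (Fin order) 0ℓ
  Isolated v = ∀ w → ¬ Adj v w

  isolated? : Decidable Isolated
  isolated? v = Fin.all? λ w → ¬? (adj? v w)

  isolatedVertices : List (Fin order)
  isolatedVertices = filter isolated? (allFin order)

  -- The number k = θₜ − s of primes used.
  primeCount : ℕ
  primeCount = θₜ ∸ length isolatedVertices

  IsolatedSingleton : Pred (Subset order) 0ℓ
  IsolatedSingleton C = ∃ λ v → Isolated v × C ≡ ⁅ v ⁆

  isolatedSingleton? : Decidable IsolatedSingleton
  isolatedSingleton? C = Fin.any? λ v → isolated? v ×-dec (C ≟ₛ ⁅ v ⁆)

  -- The cliques C_{s+1}, …, C_{s+k} of a minimum covering.
  primeCliques : List (Subset order) → List (Subset order)
  primeCliques = filter (¬? ∘ isolatedSingleton?)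

  module _ (S : List (Subset order)) where

    -- The i-th of the prime cliques is assigned the (π i)-th prime.
    Assignment : Set
    Assignment = Permutation (length (primeCliques S)) primeCount

    label : Assignment → Fin order → ℕ
    label π v = if does (isolated? v) then 1 else
      product (map (λ i → nthPrime (toℕ (π ⟨$⟩ʳ i)))
        (filter (λ i → v ∈? lookup (primeCliques S) i) (allFin _)))

    codingSequence : Assignment → List ℕ
    codingSequence π = sort ℕ.≤-decTotalOrder (map (label π) (allFin order))

    IsCodingSequence : Pred (List ℕ) 0ℓ
    IsCodingSequence x = ∃ λ π → x ≡ codingSequence π

  -- "x is σ[S]".
  IsCodeOfCovering : List (Subset order) → Pred (List ℕ) 0ℓ
  IsCodeOfCovering S = IsLeast _≤ˡᵉˣ_ (IsCodingSequence S)

  -- "x is σ[S] for some minimum total clique covering S".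
  IsCoveringCode : Pred (List ℕ) 0ℓ
  IsCoveringCode x = ∃ λ S → IsMinimumCovering S × IsCodeOfCovering S x

  -- "x is σ(G)".
  IsCode : Pred (List ℕ) 0ℓ
  IsCode = IsLeast _≤ˡᵉˣ_ IsCoveringCode

private
  module Lex = DecTotalOrder (≤-decTotalOrder ℕ.<-strictTotalOrder)
  module LexExtrema = Extrema Lex.totalOrder

  ≤ˡᵉˣ-reflexive : ∀ {x y} → x ≡ y → x ≤ˡᵉˣ y
  ≤ˡᵉˣ-reflexive {x} refl = Lex.refl {x}

  least-lex : {P : Pred (List ℕ) 0ℓ} (L : List (∃ P)) → ∃ P →
              (∀ {y} → P y → Any (λ x → proj₁ x ≤ˡᵉˣ y) L) → ∃ (IsLeast _≤ˡᵉˣ_ P)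
  least-lex L x₀ complete = let x = LexExtrema.argmin proj₁ x₀ L in
    proj₁ x , proj₂ x , λ Py → LexExtrema.f[argmin]≤v⁺ x₀ L (inj₂ (complete Py))

  permutations : ∀ m n → List (Permutation m n)
  permutations m n = concatMap inverses (cartesianProduct (vecs (allFin n) m) (vecs (allFin m) n))
    module Permutations where
    inverses : Vec (Fin n) m × Vec (Fin m) n → List (Permutation m n)
    inverses (f , g) with Fin.all? (λ i → Vec.lookup f (Vec.lookup g i) Fin.≟ i)
                        | Fin.all? (λ i → Vec.lookup g (Vec.lookup f i) Fin.≟ i)
    ... | yes p | yes q = permutation (Vec.lookup f) (Vec.lookup g) p q ∷ []
    ... | _     | _     = []

  permutations-complete : ∀ {m n} (π : Permutation m n) →
    Any (λ ρ → ∀ i → ρ ⟨$⟩ʳ i ≡ π ⟨$⟩ʳ i) (permutations m n)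
  permutations-complete {m} {n} π =
    let ρ , ρ∈ , ρ≈π = find found in
    lose (∈-concatMap⁺ (Permutations.inverses m n)
           (lose (∈-cartesianProduct⁺ (∈-vecs ∈-allFin f) (∈-vecs ∈-allFin g)) ρ∈)) ρ≈π
    where
    f = Vec.tabulate (π ⟨$⟩ʳ_)
    g = Vec.tabulate (π ⟨$⟩ˡ_)
    found : Any (λ ρ → ∀ i → ρ ⟨$⟩ʳ i ≡ π ⟨$⟩ʳ i) (Permutations.inverses m n (f , g))
    found with Fin.all? (λ i → Vec.lookup f (Vec.lookup g i) Fin.≟ i)
             | Fin.all? (λ i → Vec.lookup g (Vec.lookup f i) Fin.≟ i)
    ... | yes p | yes q = here (Vec.lookup∘tabulate _)
    ... | no ¬p | _     = contradiction
      (λ i → trans (Vec.lookup∘tabulate (π ⟨$⟩ʳ_) _) (trans (cong (π ⟨$⟩ʳ_) (Vec.lookup∘tabulate (π ⟨$⟩ˡ_) i)) (inverseʳ π))) ¬p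
    ... | yes _ | no ¬q = contradiction
      (λ i → trans (Vec.lookup∘tabulate (π ⟨$⟩ˡ_) _) (trans (cong (π ⟨$⟩ˡ_) (Vec.lookup∘tabulate (π ⟨$⟩ʳ_) i)) (inverseˡ π))) ¬q

  length-filter-¬ : {A : Set} {P : Pred A 0ℓ} (P? : Decidable P) (xs : List A) →
    length xs ≡ length (filter (¬? ∘ P?) xs) + length (filter P? xs)
  length-filter-¬ P? [] = refl
  length-filter-¬ P? (x ∷ xs) with does (P? x)
  ... | true  = trans (cong suc (length-filter-¬ P? xs)) (sym (ℕ.+-suc _ _))
  ... | false = cong suc (length-filter-¬ P? xs)

module _ (G : Graph) where
  open Graph G

  private
    module _ {S : List (Subset order)} (cov : IsTotalCliqueCovering G S) where
      open IsTotalCliqueCovering cov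

      isolatedSingleton∈ : ∀ {v} → Isolated G v → ⁅ v ⁆ ∈ₗ S
      isolatedSingleton∈ {v} iso =
        let C , C∈S , v∈C = find (coversVertex v) in
        subst (_∈ₗ S)
          (⊆-antisym (sub (All.lookup cliques C∈S) v∈C) (λ x∈ → subst (_∈ C) (sym (x∈⁅y⁆⇒x≡y v x∈)) v∈C))
          C∈S
        where
        sub : ∀ {C} → IsClique G C → v ∈ C → ∀ {x} → x ∈ C → x ∈ ⁅ v ⁆
        sub clique v∈C {x} x∈C with v Fin.≟ x
        ... | yes refl = x∈⁅x⁆ v
        ... | no v≢x   = contradiction (clique v x v∈C x∈C v≢x) (iso x)

      isolatedSingletons-count : length (filter (isolatedSingleton? G) S) ≡ length (isolatedVertices G)
      isolatedSingletons-count = trans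
        (↭-length (∼bag⇒↭ (unique∧set⇒bag
          (Unique.filter⁺ (isolatedSingleton? G) distinct)
          (Unique.map⁺ ⁅⁆-injective (Unique.filter⁺ (isolated? G) (Unique.allFin⁺ order)))
          (mk⇔ to from))))
        (length-map ⁅_⁆ (isolatedVertices G))
        where
        ⁅⁆-injective : ∀ {x y : Fin order} → ⁅ x ⁆ ≡ ⁅ y ⁆ → x ≡ y
        ⁅⁆-injective {x} {y} eq = x∈⁅y⁆⇒x≡y y (subst (x ∈_) eq (x∈⁅x⁆ x))
        to : ∀ {C} → C ∈ₗ filter (isolatedSingleton? G) S → C ∈ₗ map ⁅_⁆ (isolatedVertices G)
        to C∈ with ∈-filter⁻ (isolatedSingleton? G) {xs = S} C∈
        ... | _ , v , iso , refl = ∈-map⁺ ⁅_⁆ (∈-filter⁺ (isolated? G) (∈-allFin v) iso)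
        from : ∀ {C} → C ∈ₗ map ⁅_⁆ (isolatedVertices G) → C ∈ₗ filter (isolatedSingleton? G) S
        from C∈ with ∈-map⁻ ⁅_⁆ C∈
        ... | v , v∈ , refl = let iso = proj₂ (∈-filter⁻ (isolated? G) {xs = allFin order} v∈) in
          ∈-filter⁺ (isolatedSingleton? G) (isolatedSingleton∈ iso) (v , iso , refl)

  length-primeCliques : ∀ {S} → IsMinimumCovering G S → length (primeCliques G S) ≡ primeCount G
  length-primeCliques {S} (cov , size) = begin
    length (primeCliques G S)
      ≡⟨ ℕ.m+n∸n≡m _ (length (filter (isolatedSingleton? G) S)) ⟨
    length (primeCliques G S) + length (filter (isolatedSingleton? G) S) ∸ length (filter (isolatedSingleton? G) S)
      ≡⟨ cong (_∸ length (filter (isolatedSingleton? G) S)) (length-filter-¬ (isolatedSingleton? G) S) ⟨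
    length S ∸ length (filter (isolatedSingleton? G) S)
      ≡⟨ cong (length S ∸_) (isolatedSingletons-count cov) ⟩
    length S ∸ length (isolatedVertices G)
      ≡⟨ cong (_∸ length (isolatedVertices G)) size ⟩
    primeCount G ∎
    where open ≡-Reasoning

  private
    codingSequence-cong : ∀ S {π ρ : Assignment G S} → (∀ i → π ⟨$⟩ʳ i ≡ ρ ⟨$⟩ʳ i) →
      codingSequence G S π ≡ codingSequence G S ρ
    codingSequence-cong S {π} {ρ} π≈ρ = cong (sort ℕ.≤-decTotalOrder) (map-cong label-cong (allFin order))
      where
      label-cong : ∀ v → label G S π v ≡ label G S ρ v
      label-cong v = cong (if does (isolated? G v) then 1 else_)
        (cong product (map-cong (λ i → cong (nthPrime ∘ toℕ) (π≈ρ i))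
          (filter (λ i → v ∈? lookup (primeCliques G S) i) (allFin _))))

    coveringCode : ∀ S → IsMinimumCovering G S → ∃ (IsCodeOfCovering G S)
    coveringCode S min = least-lex
      (map (λ π → codingSequence G S π , π , refl) (permutations _ _))
      (_ , cast-id (length-primeCliques min) , refl)
      λ { (π , refl) → Any.map⁺ (Any.map (λ {ρ} ρ≈π → ≤ˡᵉˣ-reflexive (codingSequence-cong S {ρ} {π} ρ≈π)) (permutations-complete π)) }

    code : ∃ (IsCode G)
    code = least-lex (concatMap candidates (families order (θₜ G))) nonempty complete
      where
      candidates : List (Subset order) → List (∃ (IsCoveringCode G))
      candidates S with isTotalCliqueCovering? G S ×-dec (length S ℕ.≟ θₜ G)
      ... | no _    = []
      ... | yes min = let x , isCode = coveringCode S min in (x , S , min , isCode) ∷ []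

      nonempty : ∃ (IsCoveringCode G)
      nonempty = let (S , min) , _ = θₜ-isLeast G ; x , isCode = coveringCode S min in x , S , min , isCode

      complete : ∀ {y} → IsCoveringCode G y → Any (λ x → proj₁ x ≤ˡᵉˣ y) (concatMap candidates (families order (θₜ G)))
      complete {y} (S , min , isCode) = Any.concatMap⁺ candidates (lose (subst (λ n → S ∈ₗ families order n) (proj₂ min) (∈-families S)) found)
        where
        found : Any (λ x → proj₁ x ≤ˡᵉˣ y) (candidates S)
        found with isTotalCliqueCovering? G S ×-dec (length S ℕ.≟ θₜ G)
        ... | no ¬min  = contradiction min ¬min
        ... | yes min′ = here (proj₂ (proj₂ (coveringCode S min′)) (proj₁ isCode))

  σ : List ℕ
  σ = proj₁ code

  σ-isCode : IsCode G σ
  σ-isCode = proj₂ code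

{-# OPTIONS --safe #-}

-- In a covering code, distinct vertices are adjacent exactly when a common
-- prime divides their labels: an edge lies in a clique of the covering, and
-- conversely a common prime names a clique containing both ends.  Hence any
-- bijection matching the labels of two graphs is an isomorphism, and equal
-- sorted label sequences provide one.  Conversely, an isomorphism carries
-- minimum coverings and their prime assignments to the other graph without
-- changing the multiset of labels, so both graphs have the same covering codes.
module Submission where

open import Defs
open import Data.Bool.Base using (if_then_else_)
open import Data.Fin.Base using (Fin; toℕ; cast)
open import Data.Fin.Permutation using (Permutation; cast-id; _∘ₚ_; _⟨$⟩ʳ_)
import Data.Fin.Properties as Fin
open import Data.Fin.Subset using (Subset; _∈_; ⁅_⁆)
open import Data.Fin.Subset.Properties using (_∈?_; x∈⁅x⁆; x∈⁅y⁆⇒x≡y; ⊆-antisym)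
open import Data.List.Base using (List; []; _∷_; length; map; filter; allFin; lookup; tabulate)
open import Data.List.Membership.Propositional using (find) renaming (_∈_ to _∈ₗ_)
open import Data.List.Membership.Propositional.Properties using (∈-allFin; ∈-filter⁺; ∈-filter⁻; ∈-lookup; ∈-map⁺; ∈-map⁻)
open import Data.List.Membership.Propositional.Properties.WithK using (unique∧set⇒bag)
open import Data.List.Properties using (filter-≐; length-map; length-tabulate; lookup-tabulate; map-∘; map-cong; map-id; map-tabulate)
open import Data.List.Relation.Binary.BagAndSetEquality using (∼bag⇒↭)
import Data.List.Relation.Binary.Lex.Strict as Lex
open import Data.List.Relation.Binary.Permutation.Homogeneous using (onIndices)
open import Data.List.Relation.Binary.Permutation.Propositional using (_↭_; ↭-sym; ↭-trans; ↭-reflexive; ↭⇒↭ₛ)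
import Data.List.Relation.Binary.Permutation.Propositional.Properties as Perm
import Data.List.Relation.Binary.Permutation.Setoid.Properties as PermSetoid
open import Data.List.Relation.Binary.Pointwise using (Pointwise-≡⇒≡)
open import Data.List.Relation.Unary.All as All using (All)
import Data.List.Relation.Unary.All.Properties as All
open import Data.List.Relation.Unary.Any as Any using (here; there)
import Data.List.Relation.Unary.Any.Properties as Any
open import Data.List.Relation.Unary.Sorted.TotalOrder.Properties using (↗↭↗⇒≋)
import Data.List.Relation.Unary.Unique.Propositional.Properties as Unique
open import Data.Nat.Base using (ℕ; zero; suc; _≤_; _<_; _<′_; <′-base; ≤′-step)
open import Data.Nat.Divisibility using (_∣_; ∣1⇒≡1)
open import Data.Nat.ListAction using (product)
open import Data.Nat.ListAction.Properties using (∈⇒∣product)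
open import Data.Nat.Primality using (Prime; euclidsLemma; prime⇒irreducible; ¬prime[1])
import Data.Nat.Properties as ℕ
open import Data.List.Sort ℕ.≤-decTotalOrder using (sort; sort-↭; sort-↗)
open import Data.Product.Base using (∃; _×_; _,_; proj₁; proj₂)
open import Data.Sum.Base using (inj₁; inj₂)
import Data.Vec.Base as Vec
import Data.Vec.Properties as Vec
open import Function.Base using (_∘_; id)
open import Function.Bundles using (_⇔_; _↔_; mk⇔; Equivalence; Injection; Inverse)
open import Function.Construct.Symmetry using (↔-sym)
open import Function.Properties.Inverse using (Inverse⇒Injection)
open import Level using (0ℓ)
open import Relation.Binary.Definitions using (tri<; tri≈; tri>)
open import Relation.Binary.PropositionalEquality using (_≡_; _≢_; refl; sym; trans; cong; subst; subst₂; setoid; module ≡-Reasoning)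
open import Relation.Nullary.Decidable using (yes; no; does; ¬?; dec-true; dec-false)
open import Relation.Nullary.Negation using (¬_; contradiction)
open import Relation.Unary using (Pred; Decidable)

-- Lists and bijections

↔-injective : {A B : Set} (b : A ↔ B) → ∀ {x y} → Inverse.to b x ≡ Inverse.to b y → x ≡ y
↔-injective b = Injection.injective (Inverse⇒Injection b)

sort-cong-↭ : ∀ {xs ys} → xs ↭ ys → sort xs ≡ sort ys
sort-cong-↭ {xs} {ys} xs↭ys = Pointwise-≡⇒≡ (↗↭↗⇒≋ ℕ.≤-totalOrder (sort-↗ xs) (sort-↗ ys)
  (↭⇒↭ₛ (↭-trans (sort-↭ xs) (↭-trans xs↭ys (↭-sym (sort-↭ ys))))))

sort-injective-↭ : ∀ {xs ys} → sort xs ≡ sort ys → xs ↭ ys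
sort-injective-↭ {xs} {ys} eq = ↭-trans (↭-sym (sort-↭ xs)) (↭-trans (↭-reflexive eq) (sort-↭ ys))

-- A permutation of lists moves positions: `onIndices` extracts that bijection, and the casts
-- identify the positions of a tabulated list with its index type. Vertices of two graphs get
-- matched by their labels in this way.
tabulate-↭⇒bijection : ∀ {A : Set} {m n} {f : Fin m → A} {g : Fin n → A} → tabulate f ↭ tabulate g →
  ∃ λ (b : Fin m ↔ Fin n) → ∀ i → f i ≡ g (Inverse.to b i)
tabulate-↭⇒bijection {A} {f = f} {g} f↭g = b , matches
  where
  ρ = onIndices (↭⇒↭ₛ f↭g)
  b = cast-id (sym (length-tabulate f)) ∘ₚ (ρ ∘ₚ cast-id (length-tabulate g))
  open ≡-Reasoning
  matches : ∀ i → f i ≡ g (b ⟨$⟩ʳ i)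
  matches i = begin
    f i
      ≡⟨ lookup-tabulate f i ⟨
    lookup (tabulate f) i′
      ≡⟨ PermSetoid.onIndices-lookup (setoid A) (↭⇒↭ₛ f↭g) i′ ⟩
    lookup (tabulate g) (ρ ⟨$⟩ʳ i′)
      ≡⟨ cong (lookup (tabulate g)) (Fin.cast-involutive (sym (length-tabulate g)) (length-tabulate g) (ρ ⟨$⟩ʳ i′)) ⟨
    lookup (tabulate g) (cast (sym (length-tabulate g)) (b ⟨$⟩ʳ i))
      ≡⟨ lookup-tabulate g (b ⟨$⟩ʳ i) ⟩
    g (b ⟨$⟩ʳ i) ∎
    where i′ = cast (sym (length-tabulate f)) i

-- Both lists are duplicate-free and contain every element of `Fin n`, so they agree as bags.
allFin-↭ : ∀ {m n} (b : Fin m ↔ Fin n) → map (Inverse.to b) (allFin m) ↭ allFin n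
allFin-↭ b = ∼bag⇒↭ (unique∧set⇒bag
  (Unique.map⁺ (↔-injective b) (Unique.allFin⁺ _)) (Unique.allFin⁺ _)
  (mk⇔ (λ _ → ∈-allFin _) (λ _ → to-surjective _)))
  where
  to-surjective : ∀ j → j ∈ₗ map (Inverse.to b) (allFin _)
  to-surjective j = subst (_∈ₗ map (Inverse.to b) (allFin _)) (Inverse.strictlyInverseˡ b j)
    (∈-map⁺ _ (∈-allFin (Inverse.from b j)))

filter-map : {A B : Set} {P : Pred A 0ℓ} {Q : Pred B 0ℓ} (P? : Decidable P) (Q? : Decidable Q)
  (f : A → B) → (∀ x → P x ⇔ Q (f x)) → ∀ xs → filter Q? (map f xs) ≡ map f (filter P? xs)
filter-map P? Q? f P⇔Q [] = refl
filter-map P? Q? f P⇔Q (x ∷ xs) with P? x | Q? (f x)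
... | yes _ | yes _ = cong (f x ∷_) (filter-map P? Q? f P⇔Q xs)
... | no _  | no _  = filter-map P? Q? f P⇔Q xs
... | yes p | no ¬q = contradiction (Equivalence.to (P⇔Q x) p) ¬q
... | no ¬p | yes q = contradiction (Equivalence.from (P⇔Q x) q) ¬p

lookup-map-cast : {A B : Set} (f : A → B) (xs : List A) (eq : length xs ≡ length (map f xs)) (i : Fin (length xs)) →
  lookup (map f xs) (cast eq i) ≡ f (lookup xs i)
lookup-map-cast f (x ∷ xs) eq Fin.zero    = refl
lookup-map-cast f (x ∷ xs) eq (Fin.suc i) = lookup-map-cast f xs (ℕ.suc-injective eq) i

-- Primes

nthPrime-prime : ∀ i → Prime (nthPrime i)
nthPrime-prime zero    = proj₁ (proj₁ (nextPrime-isLeast 0))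
nthPrime-prime (suc i) = proj₁ (proj₁ (nextPrime-isLeast (nthPrime i)))

nthPrime-mono-< : ∀ {i j} → i < j → nthPrime i < nthPrime j
-- `_<′_` grows at its upper end, matching the recursion of `nthPrime`, where each prime is chosen
-- above the previous one.
nthPrime-mono-< i<j = go (ℕ.<⇒<′ i<j)
  where
  step : ∀ i → nthPrime i < nthPrime (suc i)
  step i = proj₂ (proj₁ (nextPrime-isLeast (nthPrime i)))
  go : ∀ {i j} → i <′ j → nthPrime i < nthPrime j
  go {i} <′-base                = step i
  go {j = suc j} (≤′-step i<′j) = ℕ.<-trans (go i<′j) (step j)

nthPrime-injective : ∀ {i j} → nthPrime i ≡ nthPrime j → i ≡ j
nthPrime-injective {i} {j} eq with ℕ.<-cmp i j
... | tri< i<j _ _ = contradiction eq (ℕ.<⇒≢ (nthPrime-mono-< i<j))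
... | tri≈ _ i≡j _ = i≡j
... | tri> _ _ j<i = contradiction (sym eq) (ℕ.<⇒≢ (nthPrime-mono-< j<i))

prime∣prime⇒≡ : ∀ {p q} → Prime p → Prime q → p ∣ q → p ≡ q
prime∣prime⇒≡ pp pq p∣q with prime⇒irreducible pq p∣q
... | inj₁ refl = contradiction pp ¬prime[1]
... | inj₂ p≡q  = p≡q

-- Euclid's lemma puts `p` under a single factor, and a prime dividing a prime equals it. The empty
-- product is 1, which no prime divides.
prime∣product⇒∈ : ∀ {p} → Prime p → ∀ {ns} → All Prime ns → p ∣ product ns → p ∈ₗ ns
prime∣product⇒∈ pp All.[] p∣ = contradiction (subst Prime (∣1⇒≡1 p∣) pp) ¬prime[1]
prime∣product⇒∈ pp {n ∷ ns} (pn All.∷ pns) p∣ with euclidsLemma n (product ns) pp p∣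
... | inj₁ p∣n  = here (prime∣prime⇒≡ pp pn p∣n)
... | inj₂ p∣ns = there (prime∣product⇒∈ pp pns p∣ns)

-- The prime is kept as a witness, rather than a statement about the gcd, because it identifies a
-- clique.
CommonPrime : ℕ → ℕ → Set
CommonPrime m n = ∃ λ p → Prime p × p ∣ m × p ∣ n

-- Labels and adjacency

-- `label` and `IsCodingSequence` depend on a covering only through the indexed
-- family of its prime cliques; isolating that family avoids transporting
-- permutations along equalities of list lengths.
module _ (G : Graph) {l k} (P : Fin l → Subset (Graph.order G)) (π : Permutation l k) where

  familyPrimes : Fin (Graph.order G) → List ℕ
  familyPrimes v = map (λ i → nthPrime (toℕ (π ⟨$⟩ʳ i))) (filter (λ i → v ∈? P i) (allFin l))

  familyLabel : Fin (Graph.order G) → ℕ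
  familyLabel v = if does (isolated? G v) then 1 else product (familyPrimes v)

  familyLabel-isolated : ∀ {v} → Isolated G v → familyLabel v ≡ 1
  familyLabel-isolated {v} iso = cong (if_then 1 else product (familyPrimes v)) (dec-true (isolated? G v) iso)

  familyLabel-nonIsolated : ∀ {v} → ¬ Isolated G v → familyLabel v ≡ product (familyPrimes v)
  familyLabel-nonIsolated {v} ¬iso = cong (if_then 1 else product (familyPrimes v)) (dec-false (isolated? G v) ¬iso)

module _ (G : Graph) where
  open Graph G

  adjacent⇒nonIsolated : ∀ {u v} → Adj u v → ¬ Isolated G u
  adjacent⇒nonIsolated uv iso = iso _ uv

  module _ {S : List (Subset order)} (cov : IsTotalCliqueCovering G S) (π : Assignment G S) where
    open IsTotalCliqueCovering cov

    cliquePrime : Fin (length (primeCliques G S)) → ℕ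
    cliquePrime i = nthPrime (toℕ (π ⟨$⟩ʳ i))

    -- Assignments are bijective and the primes are enumerated without repetition, so a prime names
    -- at most one clique.
    cliquePrime-injective : ∀ {i j} → cliquePrime i ≡ cliquePrime j → i ≡ j
    cliquePrime-injective = ↔-injective π ∘ Fin.toℕ-injective ∘ nthPrime-injective

    cliquePrime∣label : ∀ {v i} → ¬ Isolated G v → v ∈ lookup (primeCliques G S) i → cliquePrime i ∣ label G S π v
    cliquePrime∣label {v} {i} ¬iso v∈ = subst (cliquePrime i ∣_) (sym (familyLabel-nonIsolated G _ π ¬iso))
      (∈⇒∣product {ns = familyPrimes G _ π v}
        (∈-map⁺ cliquePrime (∈-filter⁺ (λ i → v ∈? lookup (primeCliques G S) i) (∈-allFin i) v∈)))

    -- An isolated vertex has label 1, which has no prime divisor; any other label is a product of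
    -- clique primes, so `p` is one of them.
    prime∣label : ∀ {p v} → Prime p → p ∣ label G S π v →
      ∃ λ i → v ∈ lookup (primeCliques G S) i × p ≡ cliquePrime i
    prime∣label {p} {v} pp p∣ with isolated? G v
    ... | yes iso = contradiction (subst Prime (∣1⇒≡1 (subst (p ∣_) (familyLabel-isolated G _ π iso) p∣)) pp) ¬prime[1]
    ... | no ¬iso =
      let i , i∈ , p≡ = ∈-map⁻ cliquePrime (prime∣product⇒∈ pp {familyPrimes G _ π v}
            (All.map⁺ (All.universal (λ i → nthPrime-prime (toℕ (π ⟨$⟩ʳ i))) _))
            (subst (p ∣_) (familyLabel-nonIsolated G _ π ¬iso) p∣))
      in i , proj₂ (∈-filter⁻ (λ i → v ∈? lookup (primeCliques G S) i) {xs = allFin _} i∈) , p≡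

    adjacent⇒commonPrime : ∀ {u v} → Adj u v → CommonPrime (label G S π u) (label G S π v)
    adjacent⇒commonPrime {u} {v} uv =
      let C , C∈S , u∈C , v∈C = find (coversEdge u v uv)
          C∈P : C ∈ₗ primeCliques G S
          -- A clique that covers an edge survives the filter: if it were an isolated singleton, its
          -- element would be `u`, which has the neighbour `v`.
          C∈P = ∈-filter⁺ (¬? ∘ isolatedSingleton? G) C∈S λ (w , iso , C≡⁅w⁆) →
                  adjacent⇒nonIsolated uv (subst (Isolated G) (sym (x∈⁅y⁆⇒x≡y w (subst (u ∈_) C≡⁅w⁆ u∈C))) iso)
          C≡ = Any.lookup-index C∈P
          i = Any.index C∈P
      in cliquePrime i , nthPrime-prime (toℕ (π ⟨$⟩ʳ i))
       , cliquePrime∣label (adjacent⇒nonIsolated uv) (subst (u ∈_) C≡ u∈C)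
       , cliquePrime∣label (adjacent⇒nonIsolated (symmetric uv)) (subst (v ∈_) C≡ v∈C)

    commonPrime⇒adjacent : ∀ {u v} → u ≢ v → CommonPrime (label G S π u) (label G S π v) → Adj u v
    commonPrime⇒adjacent {u} {v} u≢v (p , pp , p∣u , p∣v) =
      let i , u∈ , p≡i = prime∣label pp p∣u
          j , v∈ , p≡j = prime∣label pp p∣v
          j≡i = cliquePrime-injective (trans (sym p≡j) p≡i)
          clique = All.lookup cliques (proj₁ (∈-filter⁻ (¬? ∘ isolatedSingleton? G) {xs = S} (∈-lookup i)))
      in clique u v u∈ (subst (λ j → v ∈ lookup (primeCliques G S) j) j≡i v∈) u≢v

  -- What recovering a graph from `x` uses, with the covering and the assignment forgotten, so that
  -- sequences from unrelated coverings of two graphs can be compared. Distinctness appears in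
  -- `adjacent` because a non-isolated vertex shares primes with itself.
  record Decoding (x : List ℕ) : Set where
    field
      labelling : Fin order → ℕ
      sorted    : x ≡ sort (map labelling (allFin order))
      adjacent  : ∀ {u v} → u ≢ v → Adj u v ⇔ CommonPrime (labelling u) (labelling v)

  decode : ∀ {x} → IsCoveringCode G x → Decoding x
  decode (S , (cov , _) , ((π , eq) , _)) = record
    { labelling = label G S π
    ; sorted    = eq
    ; adjacent  = λ u≢v → mk⇔ (adjacent⇒commonPrime cov π) (commonPrime⇒adjacent cov π u≢v)
    }

-- Recovering a graph from its code

decoding-unique : ∀ {G H x} → Decoding G x → Decoding H x → G ≅ H
decoding-unique {G} {H} decG decH = record { bijection = b ; adjacency = adjacency }
  where
  module G = Graph G
  module H = Graph H
  module DG = Decoding decG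
  module DH = Decoding decH
  -- Since `allFin` is `tabulate id`, both lists of labels are tabulations; sorting each gives `x`,
  -- so they are permutations of each other.
  matching = tabulate-↭⇒bijection (subst₂ _↭_ (map-tabulate id DG.labelling) (map-tabulate id DH.labelling)
    (sort-injective-↭ (trans (sym DG.sorted) DH.sorted)))
  b = proj₁ matching
  f = Inverse.to b
  adjacency : ∀ u v → G.Adj u v ⇔ H.Adj (f u) (f v)
  adjacency u v with u Fin.≟ v
  ... | yes refl = mk⇔ (λ a → contradiction a G.loopless) (λ a → contradiction a H.loopless)
  ... | no u≢v   = mk⇔
    (λ a → Equivalence.from (DH.adjacent fu≢fv)
      (subst₂ CommonPrime (proj₂ matching u) (proj₂ matching v) (Equivalence.to (DG.adjacent u≢v) a)))
    (λ a → Equivalence.from (DG.adjacent u≢v)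
      (subst₂ CommonPrime (sym (proj₂ matching u)) (sym (proj₂ matching v)) (Equivalence.to (DH.adjacent fu≢fv) a)))
    where
    fu≢fv : f u ≢ f v
    fu≢fv = u≢v ∘ ↔-injective b

-- Each code is attained by a covering of its graph, so the common sequence decodes in both graphs.
σ-injective : ∀ G H → σ G ≡ σ H → G ≅ H
σ-injective G H σ≡ = decoding-unique
  (decode G {σ G} (proj₁ (σ-isCode G)))
  (decode H {σ G} (subst (IsCoveringCode H) (sym σ≡) (proj₁ (σ-isCode H))))

-- Transport along an isomorphism

≅-sym : ∀ {G H} → G ≅ H → H ≅ G
≅-sym {G} {H} i = record
  { bijection = ↔-sym bijection
  ; adjacency = λ u v → mk⇔
      (λ a → Equivalence.from (adjacency _ _) (subst₂ H.Adj (sym (Inverse.strictlyInverseˡ bijection u)) (sym (Inverse.strictlyInverseˡ bijection v)) a))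
      (λ a → subst₂ H.Adj (Inverse.strictlyInverseˡ bijection u) (Inverse.strictlyInverseˡ bijection v) (Equivalence.to (adjacency _ _) a))
  }
  where
  open _≅_ i
  module H = Graph H

-- Images of vertex sets under a bijection

image : ∀ {m n} → Fin m ↔ Fin n → Subset m → Subset n
image b C = Vec.tabulate λ w → Vec.lookup C (Inverse.from b w)

module _ {m n} (b : Fin m ↔ Fin n) where
  open Inverse b using (to; from; strictlyInverseˡ; strictlyInverseʳ)

  ∈-image⁺ : ∀ {C v} → v ∈ C → to v ∈ image b C
  ∈-image⁺ {C} {v} v∈C = Vec.lookup⇒[]= (to v) (image b C)
    (trans (Vec.lookup∘tabulate _ (to v)) (trans (cong (Vec.lookup C) (strictlyInverseʳ v)) (Vec.[]=⇒lookup v∈C)))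

  ∈-image⁻ : ∀ {C w} → w ∈ image b C → from w ∈ C
  ∈-image⁻ {C} {w} w∈ = Vec.lookup⇒[]= (from w) C (trans (sym (Vec.lookup∘tabulate _ w)) (Vec.[]=⇒lookup w∈))

  ∈-image : ∀ {C} v → v ∈ C ⇔ to v ∈ image b C
  ∈-image {C} v = mk⇔ ∈-image⁺ (subst (_∈ C) (strictlyInverseʳ v) ∘ ∈-image⁻)

  image-singleton : ∀ v → image b ⁅ v ⁆ ≡ ⁅ to v ⁆
  image-singleton v = ⊆-antisym
    (λ {w} w∈ → subst (_∈ ⁅ to v ⁆) (trans (cong to (sym (x∈⁅y⁆⇒x≡y v (∈-image⁻ w∈)))) (strictlyInverseˡ w)) (x∈⁅x⁆ (to v)))
    (λ w∈ → subst (_∈ image b ⁅ v ⁆) (sym (x∈⁅y⁆⇒x≡y (to v) w∈)) (∈-image⁺ (x∈⁅x⁆ v)))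

image-image-sym : ∀ {m n} (b : Fin m ↔ Fin n) C → image (↔-sym b) (image b C) ≡ C
image-image-sym b C = ⊆-antisym
  (λ {v} v∈ → Equivalence.from (∈-image b v) (∈-image⁻ (↔-sym b) v∈))
  (λ {v} v∈ → subst (_∈ image (↔-sym b) (image b C)) (Inverse.strictlyInverseʳ b v)
    (∈-image⁺ (↔-sym b) (∈-image⁺ b v∈)))

image-injective : ∀ {m n} (b : Fin m ↔ Fin n) {C D} → image b C ≡ image b D → C ≡ D
image-injective b {C} {D} eq =
  trans (sym (image-image-sym b C)) (trans (cong (image (↔-sym b)) eq) (image-image-sym b D))

map-image-image-sym : ∀ {m n} (b : Fin m ↔ Fin n) S → map (image (↔-sym b)) (map (image b) S) ≡ S
map-image-image-sym b S = trans (sym (map-∘ S)) (trans (map-cong (image-image-sym b) S) (map-id S))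

-- At `lookup (primeCliques G S)` and `primeCount G` this unfolds to `IsCodingSequence G S`. With
-- `k` a variable, an equality of prime counts can be matched with `refl`.
IsFamilyCoding : ∀ G {l} → (Fin l → Subset (Graph.order G)) → ℕ → Pred (List ℕ) 0ℓ
IsFamilyCoding G {l} P k x = ∃ λ (π : Permutation l k) → x ≡ sort (map (familyLabel G P π) (allFin (Graph.order G)))

-- A neighbour of the image would pull back to a neighbour of `v`. Stated for arbitrary
-- isomorphisms, so that it also applies to `≅-sym i`.
isolated-resp-≅ : ∀ {G H} (i : G ≅ H) {v} → Isolated G v → Isolated H (Inverse.to (_≅_.bijection i) v)
isolated-resp-≅ {G} {H} i {v} iso w a = iso (Inverse.from bijection w)
  (Equivalence.from (adjacency _ _) (subst (Graph.Adj H _) (sym (Inverse.strictlyInverseˡ bijection w)) a))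
  where open _≅_ i

module _ {G H : Graph} (i : G ≅ H) where
  private
    module G = Graph G
    module H = Graph H
  open _≅_ i
  open Inverse bijection using (to; from; strictlyInverseˡ; strictlyInverseʳ)

  isolated-≅ : ∀ v → Isolated G v ⇔ Isolated H (to v)
  isolated-≅ v = mk⇔ (isolated-resp-≅ i) (subst (Isolated G) (strictlyInverseʳ v) ∘ isolated-resp-≅ (≅-sym i))

  familyLabel-≅ : ∀ {l k} {P : Fin l → Subset G.order} {Q : Fin l → Subset H.order} (π : Permutation l k) →
    (∀ j v → v ∈ P j ⇔ to v ∈ Q j) → ∀ v → familyLabel H Q π (to v) ≡ familyLabel G P π v
  familyLabel-≅ {P = P} {Q} π P⇔Q v with isolated? G v
  ... | yes iso = trans (familyLabel-isolated H Q π (Equivalence.to (isolated-≅ v) iso))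
                        (sym (familyLabel-isolated G P π iso))
  ... | no ¬iso = trans (familyLabel-nonIsolated H Q π (¬iso ∘ Equivalence.from (isolated-≅ v)))
    (trans (cong (product ∘ map _)
      (filter-≐ _ _ ((λ {j} → Equivalence.from (P⇔Q j v)) , (λ {j} → Equivalence.to (P⇔Q j v))) (allFin _)))
    (sym (familyLabel-nonIsolated G P π ¬iso)))

  -- The same assignment `π` serves for both graphs: corresponding vertices get equal labels, and
  -- sorting removes the difference in the order in which the vertices are listed.
  familyCoding-≅ : ∀ {l l′ k k′} {P : Fin l → Subset G.order} {Q : Fin l′ → Subset H.order} →
    (l≡l′ : l ≡ l′) → k ≡ k′ → (∀ j v → v ∈ P j ⇔ to v ∈ Q (cast l≡l′ j)) →
    ∀ {x} → IsFamilyCoding G P k x → IsFamilyCoding H Q k′ x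
  familyCoding-≅ {l = l} {P = P} {Q} refl refl P⇔Q {x} (π , eq) = π , (begin
    x                                                       ≡⟨ eq ⟩
    sort (map (familyLabel G P π) (allFin G.order))         ≡⟨ cong sort (map-cong (familyLabel-≅ π P⇔Q′) _) ⟨
    sort (map (familyLabel H Q π ∘ to) (allFin G.order))    ≡⟨ cong sort (map-∘ _) ⟩
    sort (map (familyLabel H Q π) (map to (allFin G.order))) ≡⟨ sort-cong-↭ (Perm.map⁺ _ (allFin-↭ bijection)) ⟩
    sort (map (familyLabel H Q π) (allFin H.order))         ∎)
    where
    open ≡-Reasoning
    P⇔Q′ : ∀ j v → v ∈ P j ⇔ to v ∈ Q j
    -- Even along `refl`, `cast` is the identity only propositionally.
    P⇔Q′ j v = subst (λ j′ → v ∈ P j ⇔ to v ∈ Q j′) (Fin.cast-is-id refl j) (P⇔Q j v)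

  -- Vertices and edges of `H` are pulled back to `G`, covered there by a clique of `S`, and that
  -- clique is pushed forward.
  covering-≅ : ∀ {S} → IsTotalCliqueCovering G S → IsTotalCliqueCovering H (map (image bijection) S)
  covering-≅ {S} cov = record
    { distinct     = Unique.map⁺ (image-injective bijection) distinct
    ; cliques      = All.map⁺ (All.map image-clique cliques)
    ; coversVertex = λ w → Any.map⁺ (Any.map (λ {C} v∈ → subst (_∈ image bijection C) (strictlyInverseˡ w) (∈-image⁺ bijection v∈))
        (coversVertex (from w)))
    ; coversEdge   = λ w x a → Any.map⁺ (Any.map (λ {C} (u∈ , v∈) →
          subst (_∈ image bijection C) (strictlyInverseˡ w) (∈-image⁺ bijection u∈)
        , subst (_∈ image bijection C) (strictlyInverseˡ x) (∈-image⁺ bijection v∈))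
        (coversEdge (from w) (from x) (Equivalence.to (_≅_.adjacency (≅-sym i) w x) a)))
    }
    where
    open IsTotalCliqueCovering cov
    image-clique : ∀ {C} → IsClique G C → IsClique H (image bijection C)
    image-clique clique w x w∈ x∈ w≢x = Equivalence.from (_≅_.adjacency (≅-sym i) w x)
      (clique (from w) (from x) (∈-image⁻ bijection w∈) (∈-image⁻ bijection x∈)
        (w≢x ∘ ↔-injective (↔-sym bijection)))

  -- The image of a minimum covering of `G` is a covering of `H` of the same size. Equality follows
  -- by applying this to the inverse isomorphism too.
  θₜ-≤ : θₜ H ≤ θₜ G
  θₜ-≤ = let (S , cov , size) , _ = θₜ-isLeast G in
    proj₂ (θₜ-isLeast H) (_ , covering-≅ cov , trans (length-map _ S) size)

  isolatedSingleton-≅ : ∀ {C} → IsolatedSingleton G C → IsolatedSingleton H (image bijection C)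
  isolatedSingleton-≅ (v , iso , refl) = to v , isolated-resp-≅ i iso , image-singleton bijection v

module _ {G H : Graph} (i : G ≅ H) where
  open _≅_ i

  minimumCovering-≅ : ∀ {S} → IsMinimumCovering G S → IsMinimumCovering H (map (image bijection) S)
  minimumCovering-≅ {S} (cov , size) = covering-≅ i cov ,
    trans (length-map _ S) (trans size (ℕ.≤-antisym (θₜ-≤ (≅-sym i)) (θₜ-≤ i)))

  primeCliques-≅ : ∀ S → primeCliques H (map (image bijection) S) ≡ map (image bijection) (primeCliques G S)
  primeCliques-≅ = filter-map (¬? ∘ isolatedSingleton? G) (¬? ∘ isolatedSingleton? H) (image bijection) λ C →
    mk⇔ (λ ¬p q → ¬p (subst (IsolatedSingleton G) (image-image-sym bijection C) (isolatedSingleton-≅ (≅-sym i) q)))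
        (λ ¬q p → ¬q (isolatedSingleton-≅ i p))

  -- Each count is the number of prime cliques of a minimum covering, so comparing `S` with its
  -- image suffices.
  primeCount-≅ : ∀ {S} → IsMinimumCovering G S → primeCount G ≡ primeCount H
  primeCount-≅ {S} min = begin
    primeCount G                                        ≡⟨ length-primeCliques G min ⟨
    length (primeCliques G S)                           ≡⟨ length-map _ (primeCliques G S) ⟨
    length (map (image bijection) (primeCliques G S))   ≡⟨ cong length (primeCliques-≅ S) ⟨
    length (primeCliques H (map (image bijection) S))   ≡⟨ length-primeCliques H (minimumCovering-≅ min) ⟩
    primeCount H                                        ∎
    where open ≡-Reasoning

  codingSequence-≅ : ∀ {S} → IsMinimumCovering G S →
    ∀ {x} → IsCodingSequence G S x → IsCodingSequence H (map (image bijection) S) x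
  codingSequence-≅ {S} min {x} coding =
    -- The coding is built for the images of the prime cliques of `G`, indexed alike, and then moved
    -- to the prime cliques of the image covering.
    subst (λ P → IsFamilyCoding H (lookup P) (primeCount H) x) (sym (primeCliques-≅ S))
      (familyCoding-≅ i (sym (length-map _ P)) (primeCount-≅ min)
        (λ j v → subst (λ D → v ∈ lookup P j ⇔ Inverse.to bijection v ∈ D)
          (sym (lookup-map-cast (image bijection) P (sym (length-map _ P)) j)) (∈-image bijection v))
        coding)
    where P = primeCliques G S

-- Invariance of the code

coveringCode-≅ : ∀ {G H} → G ≅ H → ∀ {x} → IsCoveringCode G x → IsCoveringCode H x
coveringCode-≅ {G} {H} i (S , min , coding , least) =
  map (image bijection) S , minimumCovering-≅ i min , codingSequence-≅ i min coding ,
  -- Leastness transfers because any coding sequence of the image covering comes back, along the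
  -- inverse, to one of `S` itself.
  λ {y} coding′ → least (subst (λ T → IsCodingSequence G T y) (map-image-image-sym bijection S)
    (codingSequence-≅ (≅-sym i) (minimumCovering-≅ i min) coding′))
  where open _≅_ i

-- `σ H` is also a covering code of `G`, and `σ G` is the least of those.
σ-≤ : ∀ G H → G ≅ H → σ G ≤ˡᵉˣ σ H
σ-≤ G H i = proj₂ (σ-isCode G) {σ H} (coveringCode-≅ (≅-sym i) {σ H} (proj₁ (σ-isCode H)))

≤ˡᵉˣ-antisym : ∀ {x y} → x ≤ˡᵉˣ y → y ≤ˡᵉˣ x → x ≡ y
≤ˡᵉˣ-antisym x≤y y≤x = Pointwise-≡⇒≡ (Lex.≤-antisymmetric sym ℕ.<-irrefl ℕ.<-asym x≤y y≤x)

theorem3 : (G₁ G₂ : Graph) → G₁ ≅ G₂ ⇔ σ G₁ ≡ σ G₂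
theorem3 G₁ G₂ = mk⇔ (λ i → ≤ˡᵉˣ-antisym {σ G₁} {σ G₂} (σ-≤ G₁ G₂ i) (σ-≤ G₂ G₁ (≅-sym i))) (σ-injective G₁ G₂)
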